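{- Let $\sigma$ be a special $P$-morphism on $\mathcal A$, let $\mathbf t$ be an infinite word over $\mathcal A$ and $\mathbf s=\sigma(\mathbf t)$. Then $\mathbf s$ is almost rich if and only if $\mathbf t$ is almost rich.
   Context: For a finite word $w$, $D(w)=|w|+1-|\mathrm{PAL}(w)|$ with $\mathrm{PAL}(w)$ its set of distinct palindromic factors (including the empty word); an infinite word is almost rich if the defects of its factors are bounded. A standard $P$-morphism is a morphism $\varphi$ on $\mathcal A$ for which there is a palindrome $p$ (possibly empty) with $\varphi(x)=pq_x$ for all $x$, where each $q_x$ is a palindrome (possibly empty), or, when $p$ is non-empty, $q_x=\pi_x^{ -1}$ with $\pi_x$ a proper palindromic suffix of $p$. It is special if (1) the words $\varphi(x)$ end with pairwise different letters, and (2) whenever $pq_xp$ occurs as a factor of some $\varphi(y_1\cdots y_n)p$, this occurrence is the occurrence of $\varphi(y_m)p$ starting right after $\varphi(y_1\cdots y_{m-1})$ for some $1\le m\le n$. A $P$-morphism is a morphism $\psi(x)=p''q_xp'$ ($x\in\mathcal A$) obtained from a standard $P$-morphism $\varphi(x)=pq_x$ and a factorization $p=p'p''$; it is special if the corresponding standard $P$-morphism $\varphi$ is special. -}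

module Defs where

open import Data.Nat using (ℕ; zero; suc; _+_; _∸_; _≤_; _<_)
open import Data.Fin using (Fin)
open import Data.Fin.Properties using () renaming (_≟_ to _≟ᶠ_)
open import Data.List using (List; []; _∷_; _++_; length; reverse; concatMap; inits; tails; filter; deduplicate; take)
open import Data.List.Properties using (≡-dec)
open import Data.Product using (Σ; ∃; ∃-syntax; _×_; _,_)
open import Data.Sum using (_⊎_)
open import Function.Definitions using (Injective)
open import Relation.Binary.PropositionalEquality using (_≡_; _≢_)
open import Relation.Binary.Definitions using (DecidableEquality)
open import Function.Bundles using (_⇔_)
import Relation.Nullary

Alphabet : ℕ → Set
Alphabet k = Fin k

Word : ℕ → Set
Word k = List (Alphabet k)

InfWord : ℕ → Set
InfWord k = ℕ → Alphabet k

module _ {k : ℕ} where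

  _≟w_ : DecidableEquality (Word k)
  _≟w_ = ≡-dec _≟ᶠ_

  IsPalindrome : Word k → Set
  IsPalindrome w = reverse w ≡ w

  isPalindrome? : (w : Word k) → Relation.Nullary.Dec (IsPalindrome w)
  isPalindrome? w = reverse w ≟w w

  factors : Word k → List (Word k)
  factors w = concatMap inits (tails w)

  PAL : Word k → List (Word k)
  PAL w = deduplicate _≟w_ (filter isPalindrome? (factors w))

  D : Word k → ℕ
  D w = suc (length w) ∸ length (PAL w)

  segment : InfWord k → ℕ → ℕ → Word k
  segment t i zero = []
  segment t i (suc n) = t i ∷ segment t (suc i) n

  AlmostRich : InfWord k → Set
  AlmostRich t = ∃[ K ] ∀ i n → D (segment t i n) ≤ K

  Morphism : Set
  Morphism = Alphabet k → Word k

  _* : Morphism → Word k → Word k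
  (φ *) w = concatMap φ w

  IsImage : Morphism → InfWord k → InfWord k → Set
  IsImage σ t s = ∀ n → (σ *) (segment t 0 n) ≡ segment s 0 (length ((σ *) (segment t 0 n)))

  ProperSuffix : Word k → Word k → Set
  ProperSuffix π p = ∃[ u ] (u ++ π ≡ p × u ≢ [])

  -- φ is a standard P-morphism with respect to the palindrome p:
  -- for each x, φ(x) = p q_x with q_x a palindrome, or (p ≠ ε and)
  -- φ(x) = p π_x⁻¹, i.e. φ(x) π_x = p, with π_x a proper palindromic suffix of p.
  IsStandardP : Morphism → Word k → Set
  IsStandardP φ p =
    IsPalindrome p ×
    (∀ x → (∃[ q ] (IsPalindrome q × φ x ≡ p ++ q))
         ⊎ (p ≢ [] × ∃[ π ] (IsPalindrome π × ProperSuffix π p × φ x ++ π ≡ p)))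

  IsSpecialStd : Morphism → Word k → Set
  IsSpecialStd φ p =
    (∃[ ℓ ] (Injective _≡_ _≡_ ℓ × ∀ x → ∃[ u ] (φ x ≡ u ++ (ℓ x ∷ []))))
    ×
    -- (2) every occurrence of p q_x p = φ(x) p in φ(y₁⋯yₙ) p is the occurrence
    --     of φ(y_m) p right after φ(y₁⋯y_{m-1})
    (∀ x ys L R → (φ *) ys ++ p ≡ L ++ (φ x ++ p) ++ R →
       ∃[ ys₁ ] ∃[ y ] ∃[ ys₂ ]
         (ys ≡ ys₁ ++ y ∷ ys₂ × L ≡ (φ *) ys₁ × φ y ++ p ≡ φ x ++ p))

  -- σ is a special P-morphism: σ(x) = p'' q_x p' where φ(x) = p q_x is a
  -- special standard P-morphism and p = p' p''.  (σ(x) = p'' q_x p' is expressed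
  -- cancellation-free as p' σ(x) = φ(x) p'.)
  IsSpecialP : Morphism → Set
  IsSpecialP σ =
    ∃[ φ ] ∃[ p ] ∃[ p' ] ∃[ p'' ]
      (p ≡ p' ++ p'' × IsStandardP φ p × IsSpecialStd φ p ×
       (∀ x → p' ++ σ x ≡ φ x ++ p'))

{-# OPTIONS --safe #-}

-- Build words by adding letters on the left.  Adding a letter creates at most one new palindrome, and
-- the defect counts the letters that create none.  Write Φ(w) = φ(w)p, and let ℓx be the last letter
-- of φ(x).  Condition (2) synchronizes every occurrence of Φ(u) (u non-empty) in Φ(w) with an occurrence
-- of u in w, and condition (1) recovers the letters of w around it; so x u x is a new palindrome of
-- x w exactly when ℓx Φ(u) ℓx is a new palindrome of ℓx Φ(w).  When it is, each letter of the block
-- φ(x) creates a new palindrome.  The only exceptions come from palindromes of bounded length, and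
-- each of these is new only once.  Hence D(Φ(w)) and D(w) bound each other, by affine functions, and
-- Φ(w) differs from σ(w) only by the bounded prefix p′ and suffix p″.
module Submission where

open import Defs
open import Data.Empty using (⊥-elim)
open import Data.Fin using (Fin; zero; suc)
open import Data.List using (List; []; _∷_; _++_; [_]; length; reverse; concatMap; inits; filter; map; allFin; initLast; _∷ʳ′_)
open import Data.List.Properties using (++-assoc; ++-identityʳ; ++-cancelˡ; ++-cancelʳ; ++-conicalˡ; ++-conicalʳ; ++-monoid; length-++; reverse-++; reverse-involutive; length-reverse; length-filter; concatMap-++; ∷-injectiveˡ; ∷-injectiveʳ; ∷ʳ-injectiveˡ; ∷ʳ-injectiveʳ)
open import Data.List.Membership.Propositional using (_∈_; _∉_; find; lose)
open import Data.List.Membership.Propositional.Properties using (∈-∃++; ∈-++⁺ˡ; ∈-++⁺ʳ; ∈-++⁻; ∈-map⁺; ∈-map⁻; ∈-concatMap⁺; ∈-filter⁺; ∈-filter⁻; ∈-deduplicate⁺; ∈-deduplicate⁻; ∈-allFin)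
open import Data.List.Relation.Binary.Subset.Propositional using (_⊆_)
open import Data.List.Relation.Unary.All using (lookup)
open import Data.List.Relation.Unary.All.Properties using (¬Any⇒All¬)
open import Data.List.Relation.Unary.AllPairs using (_∷_)
open import Data.List.Relation.Unary.Any using (here; there; any?)
open import Data.List.Relation.Unary.Unique.Propositional using (Unique)
import Data.List.Relation.Unary.Unique.DecPropositional.Properties as UniqueProperties
open import Data.Nat using (ℕ; zero; suc; _+_; _*_; _∸_; _⊔_; _≤_; _<_; z≤n; s≤s)
open import Data.Nat.Properties
open import Data.Product using (∃; ∃-syntax; ∃₂; _×_; _,_; proj₁; proj₂)
open import Data.Sum using (_⊎_; inj₁; inj₂)
open import Function.Bundles using (_⇔_; mk⇔)
open import Function.Definitions using (Injective)
open import Relation.Binary.PropositionalEquality using (_≡_; _≢_; refl; sym; trans; cong; cong₂; subst; module ≡-Reasoning)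
open import Relation.Nullary using (¬_; Dec; yes; no; contradiction)
open import Relation.Nullary.Decidable using (map′; ¬?)
open import Relation.Unary using (Decidable)
open import Tactic.MonoidSolver using (solve)

-- Counting in finite lists

unique-⊆⇒length-≤ : ∀ {A : Set} {xs ys : List A} → Unique xs → xs ⊆ ys → length xs ≤ length ys
unique-⊆⇒length-≤ {xs = []} _ _ = z≤n
unique-⊆⇒length-≤ {xs = x ∷ xs} {ys} (x∉xs ∷ uxs) sub with ∈-∃++ (sub (here refl))
... | as , bs , refl = begin
  suc (length xs)             ≤⟨ s≤s (unique-⊆⇒length-≤ uxs sub′) ⟩
  suc (length (as ++ bs))     ≡⟨ cong suc (length-++ as) ⟩
  suc (length as + length bs) ≡⟨ +-suc _ _ ⟨
  length as + suc (length bs) ≡⟨ length-++ as ⟨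
  length (as ++ x ∷ bs)       ∎
  where
  open ≤-Reasoning
  sub′ : xs ⊆ as ++ bs
  sub′ z∈xs with ∈-++⁻ as (sub (there z∈xs))
  ... | inj₁ z∈as         = ∈-++⁺ˡ z∈as
  ... | inj₂ (here refl)  = ⊥-elim (lookup x∉xs z∈xs refl)
  ... | inj₂ (there z∈bs) = ∈-++⁺ʳ as z∈bs

module _ {A : Set} {P Q : A → Set} (P? : Decidable P) (Q? : Decidable Q) (P⊆Q : ∀ {x} → P x → Q x) where

  length-filter-mono-≤ : ∀ xs → length (filter P? xs) ≤ length (filter Q? xs)
  length-filter-mono-≤ [] = z≤n
  length-filter-mono-≤ (x ∷ xs) with P? x | Q? x
  ... | yes _ | yes _ = s≤s (length-filter-mono-≤ xs)
  ... | yes p | no ¬q = contradiction (P⊆Q p) ¬q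
  ... | no _  | yes _ = m≤n⇒m≤1+n (length-filter-mono-≤ xs)
  ... | no _  | no _  = length-filter-mono-≤ xs

  length-filter-mono-< : ∀ {v xs} → v ∈ xs → ¬ P v → Q v → length (filter P? xs) < length (filter Q? xs)
  length-filter-mono-< {xs = x ∷ xs} v∈ ¬p q with P? x | Q? x | v∈
  ... | yes p | yes _ | here refl = contradiction p ¬p
  ... | yes _ | yes _ | there v∈′ = s≤s (length-filter-mono-< v∈′ ¬p q)
  ... | yes p | no ¬q | _         = contradiction (P⊆Q p) ¬q
  ... | no _  | yes _ | here refl = s≤s (length-filter-mono-≤ xs)
  ... | no _  | yes _ | there v∈′ = m≤n⇒m≤1+n (length-filter-mono-< v∈′ ¬p q)
  ... | no _  | no ¬q | here refl = contradiction q ¬q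
  ... | no _  | no _  | there v∈′ = length-filter-mono-< v∈′ ¬p q

prefixes-comparable : ∀ {A : Set} (u v : List A) {r s} → u ++ r ≡ v ++ s →
  (∃[ z ] v ≡ u ++ z) ⊎ (∃[ z ] u ≡ v ++ z)
prefixes-comparable []      v  _ = inj₁ (v , refl)
prefixes-comparable (a ∷ u) [] _ = inj₂ (a ∷ u , refl)
prefixes-comparable (a ∷ u) (b ∷ v) eq with ∷-injectiveˡ eq | prefixes-comparable u v (∷-injectiveʳ eq)
... | refl | inj₁ (z , e) = inj₁ (z , cong (a ∷_) e)
... | refl | inj₂ (z , e) = inj₂ (z , cong (a ∷_) e)

-- Factors

module _ {k : ℕ} where

  infix 4 _⊑_ _⊑?_

  _⊑_ : Word k → Word k → Set
  v ⊑ w = ∃₂ λ l r → w ≡ l ++ v ++ r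

  ⊑-trans : ∀ {u v w} → u ⊑ v → v ⊑ w → u ⊑ w
  ⊑-trans {u} (l , r , refl) (l′ , r′ , refl) = l′ ++ l , r ++ r′ , solve (++-monoid (Fin k))

  ⊑-++ˡ : ∀ (u w : Word k) → w ⊑ u ++ w
  ⊑-++ˡ u w = u , [] , cong (u ++_) (sym (++-identityʳ w))

  ⊑-reverse : ∀ {v w} → v ⊑ w → reverse v ⊑ reverse w
  ⊑-reverse {v} (l , r , refl) = reverse r , reverse l , (begin
    reverse (l ++ v ++ r)                     ≡⟨ reverse-++ l (v ++ r) ⟩
    reverse (v ++ r) ++ reverse l             ≡⟨ cong (_++ reverse l) (reverse-++ v r) ⟩
    (reverse r ++ reverse v) ++ reverse l     ≡⟨ ++-assoc (reverse r) _ _ ⟩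
    reverse r ++ reverse v ++ reverse l       ∎)
    where open ≡-Reasoning

  ⊑-∷⁻ : ∀ {v x w} → v ⊑ x ∷ w → (∃[ r ] x ∷ w ≡ v ++ r) ⊎ v ⊑ w
  ⊑-∷⁻ ([]    , r , eq) = inj₁ (r , eq)
  ⊑-∷⁻ (_ ∷ l , r , eq) = inj₂ (l , r , ∷-injectiveʳ eq)

  ∈-inits⁺ : ∀ (v r : Word k) → v ∈ inits (v ++ r)
  ∈-inits⁺ []          r = here refl
  ∈-inits⁺ (x ∷ [])    r = there (here refl)
  ∈-inits⁺ (x ∷ y ∷ v) r with ∈-inits⁺ (y ∷ v) r
  ... | there v∈ = there (there (∈-map⁺ (x ∷_) v∈))

  ∈-inits⁻ : ∀ {v : Word k} w → v ∈ inits w → ∃[ r ] w ≡ v ++ r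
  ∈-inits⁻ w       (here refl)         = w , refl
  ∈-inits⁻ (x ∷ w) (there (here refl)) = w , refl
  ∈-inits⁻ (x ∷ w) (there (there v∈)) with ∈-map⁻ (x ∷_) v∈
  ... | u , u∈ , refl with ∈-inits⁻ w (there u∈)
  ... | r , eq = r , cong (x ∷_) eq

  ∈-factors⁺ : ∀ {v w : Word k} → v ⊑ w → v ∈ factors w
  ∈-factors⁺ {v} ([]    , r , refl) = ∈-++⁺ˡ (∈-inits⁺ v r)
  ∈-factors⁺ {v} (x ∷ l , r , refl) = ∈-++⁺ʳ (inits (x ∷ l ++ v ++ r)) (∈-factors⁺ (l , r , refl))

  ∈-factors⁻ : ∀ {v : Word k} w → v ∈ factors w → v ⊑ w
  ∈-factors⁻ [] (here refl) = [] , [] , refl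
  ∈-factors⁻ (x ∷ w) v∈ with ∈-++⁻ (inits (x ∷ w)) v∈
  ... | inj₁ v∈inits = [] , ∈-inits⁻ (x ∷ w) v∈inits
  ... | inj₂ v∈rest  = ⊑-trans (∈-factors⁻ w v∈rest) (⊑-++ˡ [ x ] w)

  _⊑?_ : ∀ (v w : Word k) → Dec (v ⊑ w)
  v ⊑? w = map′ (∈-factors⁻ w) ∈-factors⁺ (any? (v ≟w_) (factors w))

  ∈-PAL⁺ : ∀ {v w : Word k} → IsPalindrome v → v ⊑ w → v ∈ PAL w
  ∈-PAL⁺ pal v⊑w = ∈-deduplicate⁺ _≟w_ (∈-filter⁺ isPalindrome? (∈-factors⁺ v⊑w) pal)

  ∈-PAL⁻ : ∀ {v w : Word k} → v ∈ PAL w → IsPalindrome v × v ⊑ w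
  ∈-PAL⁻ {w = w} v∈ with ∈-filter⁻ isPalindrome? {xs = factors w} (∈-deduplicate⁻ _≟w_ _ v∈)
  ... | v∈factors , pal = pal , ∈-factors⁻ w v∈factors

  PAL-unique : ∀ (w : Word k) → Unique (PAL w)
  PAL-unique w = UniqueProperties.deduplicate-! _≟w_ (filter isPalindrome? (factors w))

  PAL-mono : ∀ {v w : Word k} → v ⊑ w → PAL v ⊆ PAL w
  PAL-mono v⊑w z∈ with ∈-PAL⁻ z∈
  ... | pal , z⊑v = ∈-PAL⁺ pal (⊑-trans z⊑v v⊑w)

  -- Defect

  NewPrefix : Alphabet k → Word k → Word k → Set
  NewPrefix x w v = IsPalindrome v × (∃[ r ] x ∷ w ≡ v ++ r) × ¬ v ⊑ w

  HasNew : Alphabet k → Word k → Set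
  HasNew x w = ∃ (NewPrefix x w)

  -- The shorter of two palindromic prefixes is also a suffix of the longer one, hence occurs in w.
  longer-not-new : ∀ {x w} (u : Word k) {z} → IsPalindrome u → IsPalindrome (u ++ z) →
    (∃[ r ] x ∷ w ≡ (u ++ z) ++ r) → ¬ u ⊑ w → u ≡ u ++ z
  longer-not-new {x} {w} u {z} pu puz (r , eq) ¬u⊑w = helper (reverse z) refl
    where
    open ≡-Reasoning
    swap : u ++ z ≡ reverse z ++ u
    swap = begin
      u ++ z                 ≡⟨ puz ⟨
      reverse (u ++ z)       ≡⟨ reverse-++ u z ⟩
      reverse z ++ reverse u ≡⟨ cong (reverse z ++_) pu ⟩
      reverse z ++ u         ∎
    helper : ∀ z′ → reverse z ≡ z′ → u ≡ u ++ z
    helper []       e = sym (trans swap (cong (_++ u) e))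
    helper (c ∷ z′) e = contradiction (z′ , r , ∷-injectiveʳ (begin
      x ∷ w               ≡⟨ eq ⟩
      (u ++ z) ++ r       ≡⟨ cong (_++ r) (trans swap (cong (_++ u) e)) ⟩
      (c ∷ z′ ++ u) ++ r  ≡⟨ cong (c ∷_) (++-assoc z′ u r) ⟩
      c ∷ z′ ++ u ++ r    ∎)) ¬u⊑w

  -- Of two comparable palindromic prefixes the shorter would recur later inside the longer. This is
  -- why one added letter creates at most one palindrome.
  newPrefix-unique : ∀ {x w u v} → NewPrefix x w u → NewPrefix x w v → u ≡ v
  newPrefix-unique {u = u} {v} (pu , (r , eu) , ¬u) (pv , (s , ev) , ¬v)
    with prefixes-comparable u v (trans (sym eu) ev)
  ... | inj₁ (z , refl) = longer-not-new u pu pv (s , ev) ¬u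
  ... | inj₂ (z , refl) = sym (longer-not-new v pv pu (r , eu) ¬v)

  -- A finite search through `PAL (x ∷ w)` suffices: a palindrome there that is missing from `w` can
  -- only occur as a prefix.
  hasNew? : ∀ x w → Dec (HasNew x w)
  hasNew? x w = map′ to from (any? (λ v → ¬? (v ⊑? w)) (PAL (x ∷ w)))
    where
    to : _ → HasNew x w
    to found with find found
    ... | v , v∈ , ¬v⊑w with ∈-PAL⁻ v∈
    ... | pal , v⊑xw with ⊑-∷⁻ v⊑xw
    ... | inj₁ pre = v , pal , pre , ¬v⊑w
    ... | inj₂ v⊑w = contradiction v⊑w ¬v⊑w
    from : HasNew x w → _
    from (v , pal , pre , ¬v⊑w) = lose (∈-PAL⁺ pal ([] , pre)) ¬v⊑w

  length-PAL-new : ∀ {x w} → HasNew x w → length (PAL (x ∷ w)) ≡ suc (length (PAL w))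
  length-PAL-new {x} {w} (v , new@(pal , pre , ¬v⊑w)) = ≤-antisym
    (unique-⊆⇒length-≤ (PAL-unique (x ∷ w)) upper)
    (unique-⊆⇒length-≤ (¬Any⇒All¬ (PAL w) v∉ ∷ PAL-unique w) lower)
    where
    v∉ : v ∉ PAL w
    v∉ v∈ = ¬v⊑w (proj₂ (∈-PAL⁻ v∈))
    upper : PAL (x ∷ w) ⊆ v ∷ PAL w
    upper {z} z∈ with ∈-PAL⁻ z∈ | z ⊑? w
    ... | palz , _    | yes z⊑w = there (∈-PAL⁺ palz z⊑w)
    ... | palz , z⊑xw | no ¬z⊑w with ⊑-∷⁻ z⊑xw
    ... | inj₁ prez = here (newPrefix-unique (palz , prez , ¬z⊑w) new)
    ... | inj₂ z⊑w  = contradiction z⊑w ¬z⊑w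
    lower : v ∷ PAL w ⊆ PAL (x ∷ w)
    lower (here refl) = ∈-PAL⁺ pal ([] , pre)
    lower (there z∈)  = PAL-mono (⊑-++ˡ [ x ] w) z∈

  length-PAL-old : ∀ {x w} → ¬ HasNew x w → length (PAL (x ∷ w)) ≡ length (PAL w)
  length-PAL-old {x} {w} ¬new = ≤-antisym
    (unique-⊆⇒length-≤ (PAL-unique (x ∷ w)) upper)
    (unique-⊆⇒length-≤ (PAL-unique w) (PAL-mono (⊑-++ˡ [ x ] w)))
    where
    upper : PAL (x ∷ w) ⊆ PAL w
    upper {z} z∈ with ∈-PAL⁻ z∈ | z ⊑? w
    ... | palz , _    | yes z⊑w = ∈-PAL⁺ palz z⊑w
    ... | palz , z⊑xw | no ¬z⊑w with ⊑-∷⁻ z⊑xw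
    ... | inj₁ prez = contradiction (z , palz , prez , ¬z⊑w) ¬new
    ... | inj₂ z⊑w  = contradiction z⊑w ¬z⊑w

  -- Keeps the truncated subtraction in `D` exact, so that `D-∷-old` can pull out a successor.
  length-PAL-≤ : ∀ (w : Word k) → length (PAL w) ≤ suc (length w)
  length-PAL-≤ [] = ≤-refl
  length-PAL-≤ (x ∷ w) with hasNew? x w
  ... | yes new = ≤-trans (≤-reflexive (length-PAL-new new)) (s≤s (length-PAL-≤ w))
  ... | no ¬new = ≤-trans (≤-reflexive (length-PAL-old ¬new)) (m≤n⇒m≤1+n (length-PAL-≤ w))

  D-∷-new : ∀ {x w} → HasNew x w → D (x ∷ w) ≡ D w
  D-∷-new {x} {w} new = cong (suc (suc (length w)) ∸_) (length-PAL-new new)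

  D-∷-old : ∀ {x w} → ¬ HasNew x w → D (x ∷ w) ≡ suc (D w)
  D-∷-old {x} {w} ¬new = trans (cong (suc (suc (length w)) ∸_) (length-PAL-old ¬new))
    (+-∸-assoc 1 (length-PAL-≤ w))

  D-∷-lower : ∀ x w → D w ≤ D (x ∷ w)
  D-∷-lower x w with hasNew? x w
  ... | yes new = ≤-reflexive (sym (D-∷-new new))
  ... | no ¬new = ≤-trans (n≤1+n _) (≤-reflexive (sym (D-∷-old ¬new)))

  D-∷-upper : ∀ x w → D (x ∷ w) ≤ suc (D w)
  D-∷-upper x w with hasNew? x w
  ... | yes new = ≤-trans (≤-reflexive (D-∷-new new)) (n≤1+n _)
  ... | no ¬new = ≤-reflexive (D-∷-old ¬new)

  D-++ˡ-lower : ∀ u w → D w ≤ D (u ++ w)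
  D-++ˡ-lower []      w = ≤-refl
  D-++ˡ-lower (x ∷ u) w = ≤-trans (D-++ˡ-lower u w) (D-∷-lower x (u ++ w))

  D-++ˡ-upper : ∀ u w → D (u ++ w) ≤ length u + D w
  D-++ˡ-upper []      w = ≤-refl
  D-++ˡ-upper (x ∷ u) w = ≤-trans (D-∷-upper x (u ++ w)) (s≤s (D-++ˡ-upper u w))

  PAL-reverse-⊆ : ∀ w → PAL (reverse w) ⊆ PAL w
  PAL-reverse-⊆ w {z} z∈ with ∈-PAL⁻ {w = reverse w} z∈
  ... | pal , z⊑ = ∈-PAL⁺ pal (subst (_⊑ w) pal (subst (reverse z ⊑_) (reverse-involutive w) (⊑-reverse z⊑)))

  -- Reversal fixes every palindromic factor. The bounds for extensions on the left thereby carry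
  -- over to the right.
  D-reverse : ∀ w → D (reverse w) ≡ D w
  D-reverse w = cong₂ (λ m n → suc m ∸ n) (length-reverse w) (≤-antisym
    (unique-⊆⇒length-≤ (PAL-unique (reverse w)) (PAL-reverse-⊆ w))
    (unique-⊆⇒length-≤ (PAL-unique w)
      (subst (λ z → PAL z ⊆ PAL (reverse w)) (reverse-involutive w) (PAL-reverse-⊆ (reverse w)))))

  D-++-reverse : ∀ w u → D (reverse u ++ reverse w) ≡ D (w ++ u)
  D-++-reverse w u = trans (cong D (sym (reverse-++ w u))) (D-reverse (w ++ u))

  D-++ʳ-lower : ∀ w u → D w ≤ D (w ++ u)
  D-++ʳ-lower w u = begin
    D w                          ≡⟨ D-reverse w ⟨
    D (reverse w)                ≤⟨ D-++ˡ-lower (reverse u) (reverse w) ⟩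
    D (reverse u ++ reverse w)   ≡⟨ D-++-reverse w u ⟩
    D (w ++ u)                   ∎
    where open ≤-Reasoning

  D-++ʳ-upper : ∀ w u → D (w ++ u) ≤ length u + D w
  D-++ʳ-upper w u = begin
    D (w ++ u)                       ≡⟨ D-++-reverse w u ⟨
    D (reverse u ++ reverse w)       ≤⟨ D-++ˡ-upper (reverse u) (reverse w) ⟩
    length (reverse u) + D (reverse w) ≡⟨ cong₂ _+_ (length-reverse u) (D-reverse w) ⟩
    length u + D w                   ∎
    where open ≤-Reasoning

  -- First occurrences of words from a finite list

  occurring : List (Word k) → Word k → ℕ
  occurring S w = length (filter (_⊑? w) S)

  occurring-≤ : ∀ S w → occurring S w ≤ length S
  occurring-≤ S w = length-filter (_⊑? w) S

  occurring-mono-≤ : ∀ S {w w′} → w ⊑ w′ → occurring S w ≤ occurring S w′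
  occurring-mono-≤ S {w} {w′} w⊑w′ = length-filter-mono-≤ (_⊑? w) (_⊑? w′) (λ v⊑w → ⊑-trans v⊑w w⊑w′) S

  -- Charges exceptional steps to a finite supply: each first appearance of a member of `S` raises a
  -- count that never falls and never exceeds `length S`.
  occurring-mono-< : ∀ S {v w w′} → v ∈ S → w ⊑ w′ → ¬ v ⊑ w → v ⊑ w′ → occurring S w < occurring S w′
  occurring-mono-< S {v} {w} {w′} v∈S w⊑w′ = length-filter-mono-< (_⊑? w) (_⊑? w′) (λ v⊑w → ⊑-trans v⊑w w⊑w′) v∈S

  shortWords : ℕ → List (Word k)
  shortWords zero    = [ [] ]
  shortWords (suc n) = [] ∷ concatMap (λ v → map (_∷ v) (allFin k)) (shortWords n)

  ∈-shortWords : ∀ {n} (v : Word k) → length v ≤ n → v ∈ shortWords n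
  ∈-shortWords {zero}  []      _         = here refl
  ∈-shortWords {suc n} []      _         = here refl
  ∈-shortWords {suc n} (x ∷ v) (s≤s v≤n) =
    there (∈-concatMap⁺ (λ v → map (_∷ v) (allFin k)) (lose (∈-shortWords v v≤n) (∈-map⁺ (_∷ v) (∈-allFin x))))

  -- Building and peeling palindromes

  palindrome-surround : ∀ (z m : Word k) → IsPalindrome m → IsPalindrome (z ++ m ++ reverse z)
  palindrome-surround z m pal = begin
    reverse (z ++ m ++ reverse z)                   ≡⟨ reverse-++ z _ ⟩
    reverse (m ++ reverse z) ++ reverse z           ≡⟨ cong (_++ reverse z) (reverse-++ m _) ⟩
    (reverse (reverse z) ++ reverse m) ++ reverse z ≡⟨ ++-assoc (reverse (reverse z)) _ _ ⟩
    reverse (reverse z) ++ reverse m ++ reverse z   ≡⟨ cong₂ (λ a b → a ++ b ++ reverse z) (reverse-involutive z) pal ⟩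
    z ++ m ++ reverse z                             ∎
    where open ≡-Reasoning

  palindrome-core : ∀ x (m : Word k) → m ≢ [] → IsPalindrome (x ∷ m) →
    ∃[ u ] m ≡ u ++ [ x ] × IsPalindrome u
  palindrome-core x m m≢[] pal with initLast m
  ... | [] = contradiction refl m≢[]
  ... | u ∷ʳ′ c = u , cong (λ a → u ++ [ a ]) c≡x , ∷ʳ-injectiveˡ (reverse u) u rest
    where
    open ≡-Reasoning
    flipped : c ∷ reverse u ++ [ x ] ≡ x ∷ u ++ [ c ]
    flipped = begin
      [ c ] ++ reverse u ++ [ x ]       ≡⟨ ++-assoc [ c ] (reverse u) [ x ] ⟨
      ([ c ] ++ reverse u) ++ [ x ]     ≡⟨ cong (_++ [ x ]) (reverse-++ u [ c ]) ⟨
      reverse (u ++ [ c ]) ++ [ x ]     ≡⟨ reverse-++ [ x ] (u ++ [ c ]) ⟨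
      reverse (x ∷ u ++ [ c ])          ≡⟨ pal ⟩
      x ∷ u ++ [ c ]                    ∎
    c≡x : c ≡ x
    c≡x = ∷-injectiveˡ flipped
    rest : reverse u ++ [ x ] ≡ u ++ [ c ]
    rest = ∷-injectiveʳ flipped

  last-of-suffix : ∀ (g h f : Word k) {c} → h ≢ [] → g ++ h ≡ f ++ [ c ] → ∃[ z ] h ≡ z ++ [ c ]
  last-of-suffix g h f h≢[] eq with initLast h
  ... | []       = contradiction refl h≢[]
  ... | z₀ ∷ʳ′ d = z₀ , cong (λ a → z₀ ++ [ a ])
    (∷ʳ-injectiveʳ (g ++ z₀) f (trans (++-assoc g z₀ [ d ]) eq))

-- Special standard P-morphisms

module SpecialStandard {k : ℕ} (φ : Morphism {k}) (p : Word k)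
  (standard : IsStandardP φ p) (special : IsSpecialStd φ p) where

  private
    ℓ : Alphabet k → Alphabet k
    ℓ = proj₁ (proj₁ special)

    ℓ-injective : Injective _≡_ _≡_ ℓ
    ℓ-injective = proj₁ (proj₂ (proj₁ special))

    φ-last : ∀ x → ∃[ f ] φ x ≡ f ++ [ ℓ x ]
    φ-last = proj₂ (proj₂ (proj₁ special))

  -- Appending `p` makes the map commute with reversal, which `φ *` alone need not do; palindromes
  -- then go to palindromes.
  Φ : Word k → Word k
  Φ w = (φ *) w ++ p

  Φ-++ : ∀ u w → Φ (u ++ w) ≡ (φ *) u ++ Φ w
  Φ-++ u w = trans (cong (_++ p) (concatMap-++ φ u w)) (++-assoc ((φ *) u) _ p)

  Φ-∷ : ∀ x w → Φ (x ∷ w) ≡ φ x ++ Φ w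
  Φ-∷ x w = ++-assoc (φ x) _ p

  φ-nonempty : ∀ x → φ x ≢ []
  φ-nonempty x eq with φ-last x
  ... | f , e with ++-conicalʳ f [ ℓ x ] (trans (sym e) eq)
  ... | ()

  φ*-nonempty : ∀ w → (φ *) w ≡ [] → w ≡ []
  φ*-nonempty []      _  = refl
  φ*-nonempty (x ∷ w) eq = contradiction (++-conicalˡ (φ x) _ eq) (φ-nonempty x)

  -- The blocks agree, hence so do their last letters, and `ℓ` is injective. Condition (2)
  -- identifies a block only up to this equality.
  φ-cancel : ∀ {x y} → φ x ++ p ≡ φ y ++ p → x ≡ y
  φ-cancel {x} {y} eq with φ-last x | φ-last y
  ... | f , ef | g , eg = ℓ-injective (∷ʳ-injectiveʳ f g
    (trans (sym ef) (trans (++-cancelʳ p (φ x) (φ y) eq) eg)))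

  -- If `φ x` is `p q`, both sides are `p q p`. If `φ x ++ π` is `p`, reversing the palindrome `p`
  -- gives `π ++ reverse (φ x)`, and both sides are `φ x ++ π ++ reverse (φ x)`.
  φ-swap : ∀ x → φ x ++ p ≡ p ++ reverse (φ x)
  φ-swap x with proj₂ standard x
  ... | inj₁ (q , q-pal , e) = begin
    φ x ++ p                     ≡⟨ cong (_++ p) e ⟩
    (p ++ q) ++ p                ≡⟨ ++-assoc p q p ⟩
    p ++ q ++ p                  ≡⟨ cong₂ (λ a b → p ++ a ++ b) q-pal (proj₁ standard) ⟨
    p ++ reverse q ++ reverse p  ≡⟨ cong (p ++_) (reverse-++ p q) ⟨
    p ++ reverse (p ++ q)        ≡⟨ cong (λ a → p ++ reverse a) e ⟨
    p ++ reverse (φ x)           ∎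
    where open ≡-Reasoning
  ... | inj₂ (_ , π , π-pal , _ , e) = begin
    φ x ++ p                          ≡⟨ cong (φ x ++_) (proj₁ standard) ⟨
    φ x ++ reverse p                  ≡⟨ cong (λ a → φ x ++ reverse a) e ⟨
    φ x ++ reverse (φ x ++ π)         ≡⟨ cong (φ x ++_) (reverse-++ (φ x) π) ⟩
    φ x ++ reverse π ++ reverse (φ x) ≡⟨ cong (λ a → φ x ++ a ++ reverse (φ x)) π-pal ⟩
    φ x ++ π ++ reverse (φ x)         ≡⟨ ++-assoc (φ x) π _ ⟨
    (φ x ++ π) ++ reverse (φ x)       ≡⟨ cong (_++ reverse (φ x)) e ⟩
    p ++ reverse (φ x)                ∎
    where open ≡-Reasoning

  Φ-reverse : ∀ w → reverse (Φ w) ≡ Φ (reverse w)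
  Φ-reverse []      = proj₁ standard
  Φ-reverse (x ∷ w) = begin
    reverse (Φ (x ∷ w))                       ≡⟨ cong reverse (Φ-∷ x w) ⟩
    reverse (φ x ++ Φ w)                      ≡⟨ reverse-++ (φ x) (Φ w) ⟩
    reverse (Φ w) ++ reverse (φ x)            ≡⟨ cong (_++ reverse (φ x)) (Φ-reverse w) ⟩
    ((φ *) (reverse w) ++ p) ++ reverse (φ x) ≡⟨ ++-assoc ((φ *) (reverse w)) p _ ⟩
    (φ *) (reverse w) ++ p ++ reverse (φ x)   ≡⟨ cong ((φ *) (reverse w) ++_) (φ-swap x) ⟨
    (φ *) (reverse w) ++ φ x ++ p             ≡⟨ cong (λ a → (φ *) (reverse w) ++ a ++ p) (++-identityʳ (φ x)) ⟨
    (φ *) (reverse w) ++ Φ [ x ]              ≡⟨ Φ-++ (reverse w) [ x ] ⟨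
    Φ (reverse w ++ [ x ])                    ≡⟨ cong Φ (reverse-++ [ x ] w) ⟨
    Φ (reverse (x ∷ w))                       ∎
    where open ≡-Reasoning

  -- `φ-swap` carries the leading `p` past one block at a time. The second statement keeps the
  -- reversed block visible, because its first letter identifies `x`.
  Φ-prefix : ∀ w → ∃[ r ] Φ w ≡ p ++ r
  Φ-∷-prefix : ∀ x w → ∃[ r ] Φ (x ∷ w) ≡ p ++ reverse (φ x) ++ r

  Φ-prefix []      = [] , sym (++-identityʳ p)
  Φ-prefix (x ∷ w) with Φ-∷-prefix x w
  ... | r , e = reverse (φ x) ++ r , e

  Φ-∷-prefix x w with Φ-prefix w
  ... | r , e = r , (begin
    Φ (x ∷ w)                    ≡⟨ Φ-∷ x w ⟩
    φ x ++ Φ w                   ≡⟨ cong (φ x ++_) e ⟩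
    φ x ++ p ++ r                ≡⟨ ++-assoc (φ x) p r ⟨
    (φ x ++ p) ++ r              ≡⟨ cong (_++ r) (φ-swap x) ⟩
    (p ++ reverse (φ x)) ++ r    ≡⟨ ++-assoc p _ r ⟩
    p ++ reverse (φ x) ++ r      ∎)
    where open ≡-Reasoning

  -- Decoding letters and synchronizing occurrences

  reverse-φ : ∀ x → ∃[ f ] reverse (φ x) ≡ ℓ x ∷ f
  reverse-φ x with φ-last x
  ... | f , e = reverse f , trans (cong reverse e) (reverse-++ f [ ℓ x ])

  Φ-∷-head : ∀ x w → ∃[ r ] Φ (x ∷ w) ≡ p ++ ℓ x ∷ r
  Φ-∷-head x w with Φ-∷-prefix x w | reverse-φ x
  ... | r , e | f , e′ = f ++ r , trans e (cong (λ a → p ++ a ++ r) e′)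

  -- Right after the leading `p` stands the first letter of a reversed block, and condition (1)
  -- makes it determine the block.
  next-letter : ∀ {x r} w → Φ w ≡ p ++ ℓ x ∷ r → ∃[ w′ ] w ≡ x ∷ w′
  next-letter [] eq with ++-cancelˡ p [] _ (trans (++-identityʳ p) eq)
  ... | ()
  next-letter (c ∷ w) eq with Φ-∷-head c w
  ... | r , e = w , cong (_∷ w) (ℓ-injective (∷-injectiveˡ (++-cancelˡ p _ _ (trans (sym e) eq))))

  φ*-∷ʳ : ∀ w x → (φ *) (w ++ [ x ]) ≡ (φ *) w ++ φ x
  φ*-∷ʳ w x = trans (concatMap-++ φ w [ x ]) (cong ((φ *) w ++_) (++-identityʳ (φ x)))

  -- The same decoding on the left: a product of blocks ends with the last letter of its last block.
  previous-letter : ∀ {x} l w → l ++ [ ℓ x ] ≡ (φ *) w → ∃[ w′ ] w ≡ w′ ++ [ x ]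
  previous-letter l w eq with initLast w
  ... | [] with ++-conicalʳ l _ eq
  ...   | ()
  previous-letter {x} l w eq | w′ ∷ʳ′ d with φ-last d
  ... | f , e = w′ , cong (λ a → w′ ++ [ a ]) (sym (ℓ-injective (∷ʳ-injectiveʳ l ((φ *) w′ ++ f) (begin
    l ++ [ ℓ x ]                  ≡⟨ eq ⟩
    (φ *) (w′ ++ [ d ])           ≡⟨ φ*-∷ʳ w′ d ⟩
    (φ *) w′ ++ φ d               ≡⟨ cong ((φ *) w′ ++_) e ⟩
    (φ *) w′ ++ f ++ [ ℓ d ]      ≡⟨ ++-assoc ((φ *) w′) f _ ⟨
    ((φ *) w′ ++ f) ++ [ ℓ d ]    ∎))))
    where open ≡-Reasoning

  -- Since `Φ u` begins with `p`, the occurrence begins with `φ x ++ p`, to which condition (2)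
  -- applies; `φ-cancel` shows that the letter found there is `x`.
  synchronize-head : ∀ x u ys l r → Φ ys ≡ l ++ Φ (x ∷ u) ++ r →
    ∃₂ λ ys₁ ys₂ → ys ≡ ys₁ ++ x ∷ ys₂ × l ≡ (φ *) ys₁ × Φ ys₂ ≡ Φ u ++ r
  synchronize-head x u ys l r eq with Φ-prefix u
  ... | q , e with proj₂ special x ys l (q ++ r) (trans eq (cong (l ++_) (begin
      Φ (x ∷ u) ++ r             ≡⟨ cong (_++ r) (trans (Φ-∷ x u) (cong (φ x ++_) e)) ⟩
      (φ x ++ p ++ q) ++ r       ≡⟨ lemma (φ x) p q r ⟩
      (φ x ++ p) ++ q ++ r       ∎)))
    where
    open ≡-Reasoning
    lemma : ∀ (a b c d : Word k) → (a ++ b ++ c) ++ d ≡ (a ++ b) ++ c ++ d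
    lemma a b c d = solve (++-monoid (Fin k))
  ... | ys₁ , y , ys₂ , refl , refl , same with φ-cancel same
  ... | refl = ys₁ , ys₂ , refl , refl , ++-cancelˡ (φ x) _ _ (++-cancelˡ ((φ *) ys₁) _ _ (begin
    (φ *) ys₁ ++ φ x ++ Φ ys₂   ≡⟨ cong ((φ *) ys₁ ++_) (Φ-∷ x ys₂) ⟨
    (φ *) ys₁ ++ Φ (x ∷ ys₂)    ≡⟨ Φ-++ ys₁ (x ∷ ys₂) ⟨
    Φ (ys₁ ++ x ∷ ys₂)          ≡⟨ eq ⟩
    (φ *) ys₁ ++ Φ (x ∷ u) ++ r ≡⟨ cong (λ a → (φ *) ys₁ ++ a ++ r) (Φ-∷ x u) ⟩
    (φ *) ys₁ ++ (φ x ++ Φ u) ++ r ≡⟨ cong ((φ *) ys₁ ++_) (++-assoc (φ x) (Φ u) r) ⟩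
    (φ *) ys₁ ++ φ x ++ Φ u ++ r ∎))
    where open ≡-Reasoning

  -- After the first block the rest must match at once, so the gap before the next block has empty
  -- image and is empty. The last equation retains `p` and what follows it, ready for `next-letter`.
  synchronize : ∀ x u ys l r → Φ ys ≡ l ++ Φ (x ∷ u) ++ r →
    ∃₂ λ ys₁ ys₂ → ys ≡ ys₁ ++ (x ∷ u) ++ ys₂ × l ≡ (φ *) ys₁ × Φ ys₂ ≡ p ++ r
  synchronize x u ys l r eq with synchronize-head x u ys l r eq
  synchronize x []      ys l r eq | ys₁ , ys₂ , e₁ , e₂ , e₃ = ys₁ , ys₂ , e₁ , e₂ , e₃
  synchronize x (y ∷ u) ys l r eq | ys₁ , ys₂ , e₁ , e₂ , e₃ with synchronize y u ys₂ [] r e₃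
  ... | ys₃ , ys₄ , e₄ , e₅ , e₆ with φ*-nonempty ys₃ (sym e₅)
  ... | refl = ys₁ , ys₄ , trans e₁ (cong (λ a → ys₁ ++ x ∷ a) e₄) , e₂ , e₆

  -- Injectivity and palindromic images

  Φ≡p⇒[] : ∀ w → Φ w ≡ p → w ≡ []
  Φ≡p⇒[] w eq = φ*-nonempty w (++-cancelʳ p ((φ *) w) [] eq)

  Φ-injective : ∀ u v → Φ u ≡ Φ v → u ≡ v
  Φ-injective []      v eq = sym (Φ≡p⇒[] v (sym eq))
  Φ-injective (x ∷ u) v eq with synchronize x u v [] [] (trans (sym eq) (sym (++-identityʳ (Φ (x ∷ u)))))
  ... | v₁ , v₂ , e₁ , e₂ , e₃ with φ*-nonempty v₁ (sym e₂) | Φ≡p⇒[] v₂ (trans e₃ (++-identityʳ p))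
  ... | refl | refl = sym (trans e₁ (++-identityʳ (x ∷ u)))

  Φ-palindrome : ∀ u → IsPalindrome u → IsPalindrome (Φ u)
  Φ-palindrome u pal = trans (Φ-reverse u) (cong Φ pal)

  Φ-palindrome⁻ : ∀ u → IsPalindrome (Φ u) → IsPalindrome u
  Φ-palindrome⁻ u pal = Φ-injective (reverse u) u (trans (sym (Φ-reverse u)) pal)

  -- New palindromes of a word and of its image

  occurrence⁺ : ∀ {x w} u → x ∷ u ++ [ x ] ⊑ w → ℓ x ∷ Φ u ++ [ ℓ x ] ⊑ Φ w
  occurrence⁺ {x} u (l , r , refl) with φ-last x | Φ-∷-head x r
  -- The left `ℓ x` closes the block of the first `x`; the right one follows the `p` that begins the
  -- image of `x ∷ r`.
  ... | f , e | r′ , e′ = (φ *) l ++ f , r′ , (begin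
    Φ (l ++ (x ∷ u ++ [ x ]) ++ r)                   ≡⟨ Φ-++ l _ ⟩
    (φ *) l ++ Φ (x ∷ (u ++ [ x ]) ++ r)             ≡⟨ cong ((φ *) l ++_) (Φ-∷ x ((u ++ [ x ]) ++ r)) ⟩
    (φ *) l ++ φ x ++ Φ ((u ++ [ x ]) ++ r)          ≡⟨ cong (λ a → (φ *) l ++ φ x ++ Φ a) (++-assoc u [ x ] r) ⟩
    (φ *) l ++ φ x ++ Φ (u ++ x ∷ r)                 ≡⟨ cong (λ a → (φ *) l ++ φ x ++ a) (Φ-++ u (x ∷ r)) ⟩
    (φ *) l ++ φ x ++ (φ *) u ++ Φ (x ∷ r)           ≡⟨ cong₂ (λ a b → (φ *) l ++ a ++ (φ *) u ++ b) e e′ ⟩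
    (φ *) l ++ (f ++ [ ℓ x ]) ++ (φ *) u ++ p ++ [ ℓ x ] ++ r′ ≡⟨ lemma ((φ *) l) f [ ℓ x ] ((φ *) u) r′ ⟩
    ((φ *) l ++ f) ++ ([ ℓ x ] ++ Φ u ++ [ ℓ x ]) ++ r′ ∎)
    where
    open ≡-Reasoning
    lemma : ∀ (a b c d e : Word k) →
      a ++ (b ++ c) ++ d ++ p ++ c ++ e ≡ (a ++ b) ++ (c ++ (d ++ p) ++ c) ++ e
    lemma a b c d e = solve (++-monoid (Fin k))

  -- A non-empty `u` gives `synchronize` a block to hold on to, and the two outer letters decode to
  -- the neighbours of `u`. The equation for `l` records where the occurrence lies, which
  -- `new-image` uses to set aside the first block.
  occurrence⁻ : ∀ {x w} u l r → u ≢ [] → Φ w ≡ l ++ [ ℓ x ] ++ Φ u ++ [ ℓ x ] ++ r →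
    ∃₂ λ a b → w ≡ a ++ x ∷ u ++ x ∷ b × l ++ [ ℓ x ] ≡ (φ *) a ++ φ x
  occurrence⁻ [] l r u≢[] eq = contradiction refl u≢[]
  occurrence⁻ {x} {w} (c ∷ u) l r _ eq
    with synchronize c u w (l ++ [ ℓ x ]) (ℓ x ∷ r) (trans eq (sym (++-assoc l [ ℓ x ] _)))
  ... | w₁ , w₂ , e₁ , e₂ , e₃ with previous-letter l w₁ e₂ | next-letter w₂ e₃
  ... | a , refl | b , refl = a , b , trans e₁ (++-assoc a [ x ] _) , trans e₂ (φ*-∷ʳ a x)

  -- The palindrome is `Φ u` between the block suffix `y ∷ z` and its mirror image, the latter
  -- supplied by the reversed block after `p`. As `y ∷ z` ends with `ℓ x`, an earlier occurrence
  -- would decode to `x u x` inside `w`.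
  new-image : ∀ {x w} u → u ≢ [] → NewPrefix x w (x ∷ u ++ [ x ]) → IsPalindrome u →
    ∀ g {y z} → φ x ≡ g ++ y ∷ z → HasNew y (z ++ Φ w)
  new-image {x} {w} u u≢[] (_ , (r , pre) , ¬v⊑w) u-pal g {y} {z} split =
    P , palindrome-surround (y ∷ z) (Φ u) (Φ-palindrome u u-pal) , P-prefix , P-new
    where
    open ≡-Reasoning
    P : Word k
    P = (y ∷ z) ++ Φ u ++ reverse (y ∷ z)

    w≡ : w ≡ u ++ x ∷ r
    w≡ = trans (∷-injectiveʳ pre) (++-assoc u [ x ] r)

    P-prefix : ∃[ r′ ] y ∷ z ++ Φ w ≡ P ++ r′
    P-prefix with Φ-∷-prefix x r
    ... | r′ , e = reverse g ++ r′ , (begin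
      (y ∷ z) ++ Φ w
        ≡⟨ cong ((y ∷ z) ++_) (trans (cong Φ w≡) (Φ-++ u (x ∷ r))) ⟩
      (y ∷ z) ++ (φ *) u ++ Φ (x ∷ r)
        ≡⟨ cong (λ a → (y ∷ z) ++ (φ *) u ++ a) e ⟩
      (y ∷ z) ++ (φ *) u ++ p ++ reverse (φ x) ++ r′
        ≡⟨ cong (λ a → (y ∷ z) ++ (φ *) u ++ p ++ a ++ r′) (trans (cong reverse split) (reverse-++ g (y ∷ z))) ⟩
      (y ∷ z) ++ (φ *) u ++ p ++ (reverse (y ∷ z) ++ reverse g) ++ r′
        ≡⟨ lemma (y ∷ z) ((φ *) u) (reverse (y ∷ z)) (reverse g) r′ ⟩
      P ++ reverse g ++ r′ ∎)
      where
      lemma : ∀ (a b c d e : Word k) →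
        a ++ b ++ p ++ (c ++ d) ++ e ≡ (a ++ (b ++ p) ++ c) ++ d ++ e
      lemma a b c d e = solve (++-monoid (Fin k))

    P-new : ¬ P ⊑ z ++ Φ w
    P-new (l , r′ , eq) with φ-last x
    ... | f , ef with last-of-suffix g (y ∷ z) f (λ ()) (trans (sym split) ef)
    -- `z ++ Φ w` may start in the middle of a block; restoring `g` and `y` completes it to
    -- `Φ (x ∷ w)`, where occurrences can be decoded.
    ... | z₀ , ez with occurrence⁻ {x} {x ∷ w} u (g ++ [ y ] ++ l ++ z₀) (reverse z₀ ++ r′) u≢[] (begin
        Φ (x ∷ w)                                        ≡⟨ Φ-∷ x w ⟩
        φ x ++ Φ w                                       ≡⟨ cong (_++ Φ w) split ⟩
        (g ++ [ y ] ++ z) ++ Φ w                         ≡⟨ lemma₁ g [ y ] z (Φ w) ⟩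
        g ++ [ y ] ++ z ++ Φ w                           ≡⟨ cong (λ a → g ++ [ y ] ++ a) eq ⟩
        g ++ [ y ] ++ l ++ ((y ∷ z) ++ Φ u ++ reverse (y ∷ z)) ++ r′
          ≡⟨ cong (λ a → g ++ [ y ] ++ l ++ (a ++ Φ u ++ reverse a) ++ r′) ez ⟩
        g ++ [ y ] ++ l ++ ((z₀ ++ [ ℓ x ]) ++ Φ u ++ reverse (z₀ ++ [ ℓ x ])) ++ r′
          ≡⟨ cong (λ a → g ++ [ y ] ++ l ++ ((z₀ ++ [ ℓ x ]) ++ Φ u ++ a) ++ r′) (reverse-++ z₀ [ ℓ x ]) ⟩
        g ++ [ y ] ++ l ++ ((z₀ ++ [ ℓ x ]) ++ Φ u ++ [ ℓ x ] ++ reverse z₀) ++ r′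
          ≡⟨ lemma₂ g [ y ] l z₀ [ ℓ x ] (Φ u) (reverse z₀) r′ ⟩
        (g ++ [ y ] ++ l ++ z₀) ++ [ ℓ x ] ++ Φ u ++ [ ℓ x ] ++ reverse z₀ ++ r′ ∎)
      where
      lemma₁ : ∀ (a b c d : Word k) → (a ++ b ++ c) ++ d ≡ a ++ b ++ c ++ d
      lemma₁ a b c d = solve (++-monoid (Fin k))
      lemma₂ : ∀ (a b c d e m f h : Word k) →
        a ++ b ++ c ++ ((d ++ e) ++ m ++ e ++ f) ++ h ≡ (a ++ b ++ c ++ d) ++ e ++ m ++ e ++ f ++ h
      lemma₂ a b c d e m f h = solve (++-monoid (Fin k))
    -- The occurrence found in Φ (x ∷ w) starts beyond the first block φ x, so it lies over w.
    ... | [] , b , _ , e = <-irrefl (cong length (sym collapse)) (s≤s (≤-trans (m≤n+m _ (length l)) (≤-reflexive (sym (length-++ l)))))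
      where
      lemma : ∀ (a b c d e : Word k) → (a ++ b ++ c ++ d) ++ e ≡ a ++ b ++ c ++ d ++ e
      lemma a b c d e = solve (++-monoid (Fin k))
      -- With nothing before the decoded `x`, the left `ℓ x` would end the first block, equating a
      -- word with a proper suffix of itself.
      collapse : y ∷ l ++ z₀ ++ [ ℓ x ] ≡ z₀ ++ [ ℓ x ]
      collapse = trans (++-cancelˡ g _ _ (trans (sym (lemma g [ y ] l z₀ [ ℓ x ])) (trans e split))) ez
    ... | c ∷ a , b , e , _ = ¬v⊑w (a , b , trans (∷-injectiveʳ e) (cong (λ s → a ++ x ∷ s) (sym (++-assoc u [ x ] b))))

  -- A long new palindrome ℓx Q ℓx starts, after its first letter, with a block φ a ++ p, and hence
  -- by symmetry Q ends with such a block; synchronization gives Q = Φ u.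
  new-preimage : ∀ {x w v} → (∀ y → length (φ y ++ p) + 2 < length v) → length p + 1 < length v →
    NewPrefix (ℓ x) (Φ w) v → HasNew x w
  -- Over the empty word, `v` is a prefix of `ℓ x ∷ p` and thus too short.
  new-preimage {x} {[]} {v} _ long (_ , (r , pre) , _) = contradiction long (≤⇒≯ (begin
    length v            ≤⟨ m≤m+n _ (length r) ⟩
    length v + length r ≡⟨ length-++ v ⟨
    length (v ++ r)     ≡⟨ cong length pre ⟨
    suc (length p)      ≡⟨ +-comm 1 _ ⟩
    length p + 1        ∎))
    where open ≤-Reasoning
  new-preimage {v = []} _ ()
  new-preimage {x} {a ∷ w} {c ∷ m} longφ long (pal , (r , pre) , new) with ∷-injectiveˡ pre
  ... | refl with palindrome-core (ℓ x) m m≢[] pal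
    where
    m≢[] : m ≢ []
    m≢[] refl = contradiction long (≤⇒≯ (m≤n+m 1 (length p)))
  ... | Q , refl , Q-pal with Φ-prefix w
  ... | q , eq with prefixes-comparable (φ a ++ p) Q {q} {ℓ x ∷ r} (begin
      (φ a ++ p) ++ q       ≡⟨ ++-assoc (φ a) p q ⟩
      φ a ++ p ++ q         ≡⟨ cong (φ a ++_) eq ⟨
      φ a ++ Φ w            ≡⟨ Φ-∷ a w ⟨
      Φ (a ∷ w)             ≡⟨ ∷-injectiveʳ pre ⟩
      (Q ++ [ ℓ x ]) ++ r   ≡⟨ ++-assoc Q [ ℓ x ] r ⟩
      Q ++ ℓ x ∷ r          ∎)
    where open ≡-Reasoning
  -- The `2` in `longφ` accounts for the two outer letters of `v` around `Q`.
  ... | inj₂ (z , e) = contradiction (longφ a) (≤⇒≯ (begin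
    suc (length (Q ++ [ ℓ x ]))    ≡⟨ cong suc (length-++ Q) ⟩
    suc (length Q + 1)             ≡⟨ +-suc (length Q) 1 ⟨
    length Q + 2                   ≤⟨ +-monoˡ-≤ 2 (m≤m+n (length Q) (length z)) ⟩
    length Q + length z + 2        ≡⟨ cong (_+ 2) (trans (cong length e) (length-++ Q)) ⟨
    length (φ a ++ p) + 2          ∎))
    where open ≤-Reasoning
  ... | inj₁ (z , e) = result
    where
    open ≡-Reasoning
    Q≡ : Q ≡ reverse z ++ Φ [ a ]
    Q≡ = begin
      Q                                 ≡⟨ Q-pal ⟨
      reverse Q                         ≡⟨ cong reverse e ⟩
      reverse ((φ a ++ p) ++ z)         ≡⟨ cong (λ b → reverse ((b ++ p) ++ z)) (++-identityʳ (φ a)) ⟨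
      reverse (Φ [ a ] ++ z)            ≡⟨ reverse-++ (Φ [ a ]) z ⟩
      reverse z ++ reverse (Φ [ a ])    ≡⟨ cong (reverse z ++_) (Φ-reverse [ a ]) ⟩
      reverse z ++ Φ [ a ]              ∎

    occ : Φ (a ∷ w) ≡ reverse z ++ Φ [ a ] ++ ℓ x ∷ r
    occ = begin
      Φ (a ∷ w)                             ≡⟨ ∷-injectiveʳ pre ⟩
      (Q ++ [ ℓ x ]) ++ r                   ≡⟨ ++-assoc Q [ ℓ x ] r ⟩
      Q ++ ℓ x ∷ r                          ≡⟨ cong (_++ ℓ x ∷ r) Q≡ ⟩
      (reverse z ++ Φ [ a ]) ++ ℓ x ∷ r     ≡⟨ ++-assoc (reverse z) (Φ [ a ]) _ ⟩
      reverse z ++ Φ [ a ] ++ ℓ x ∷ r       ∎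

    result : HasNew x (a ∷ w)
    result with synchronize a [] (a ∷ w) (reverse z) (ℓ x ∷ r) occ
    ... | w₁ , w₂ , e₁ , e₂ , e₃ with next-letter w₂ e₃
    ... | w₃ , refl = x ∷ u ++ [ x ] , palindrome-surround [ x ] u u-pal , (w₃ , cong (x ∷_) prefix) ,
      λ v⊑w → new (subst (λ b → ℓ x ∷ b ++ [ ℓ x ] ⊑ Φ (a ∷ w)) (sym Q≡Φu) (occurrence⁺ u v⊑w))
      where
      u : Word k
      u = w₁ ++ [ a ]
      Q≡Φu : Q ≡ Φ u
      Q≡Φu = trans Q≡ (trans (cong (_++ Φ [ a ]) e₂) (sym (Φ-++ w₁ [ a ])))
      u-pal : IsPalindrome u
      u-pal = Φ-palindrome⁻ u (subst IsPalindrome Q≡Φu Q-pal)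
      prefix : a ∷ w ≡ (u ++ [ x ]) ++ w₃
      prefix = trans e₁ (lemma w₁ [ a ] [ x ] w₃)
        where
        lemma : ∀ (b c d f : Word k) → b ++ c ++ d ++ f ≡ ((b ++ c) ++ d) ++ f
        lemma b c d f = solve (++-monoid (Fin k))

  -- The block is prepended from its end, `h` being the part already in place; by `new-image` every
  -- one of its letters creates a palindrome.
  D-∷-image : ∀ {x w} u → u ≢ [] → NewPrefix x w (x ∷ u ++ [ x ]) → IsPalindrome u →
    ∀ g h → φ x ≡ g ++ h → D (h ++ Φ w) ≡ D (Φ w)
  D-∷-image u u≢[] new u-pal g []      split = refl
  D-∷-image u u≢[] new u-pal g (y ∷ z) split = trans
    (D-∷-new (new-image u u≢[] new u-pal g split))
    (D-∷-image u u≢[] new u-pal (g ++ [ y ]) z (trans split (sym (++-assoc g [ y ] z))))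

  -- Affine bounds between the two defects

  module Bounds (M : ℕ) (φ-≤ : ∀ x → length (φ x) ≤ M) where

    -- Chosen so that a palindrome longer than `B` meets both length hypotheses of `new-preimage`.
    B : ℕ
    B = M + length p + 2

    -- If `x` creates `x u x` with `u` non-empty, its block costs nothing. Otherwise it costs at
    -- most `M`, and the sum in parentheses grows: either the defect rises or a word of length at
    -- most 2 appears for the first time. The threshold is 2 because `x x` has an empty core.
    D-image-upper : ∀ w → D (Φ w) ≤ D p + M * (D w + occurring (shortWords 2) w)
    D-image-upper []      = m≤m+n (D p) _
    D-image-upper (x ∷ w) = ≤-trans (≤-reflexive (cong D (Φ-∷ x w))) step
      where
      open ≤-Reasoning
      short : Word k → ℕ
      short = occurring (shortWords 2)
      short-≤ : short w ≤ short (x ∷ w)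
      short-≤ = occurring-mono-≤ (shortWords 2) (⊑-++ˡ [ x ] w)
      bad : suc (D w + short w) ≤ D (x ∷ w) + short (x ∷ w) →
        D (φ x ++ Φ w) ≤ D p + M * (D (x ∷ w) + short (x ∷ w))
      bad more = begin
        D (φ x ++ Φ w)                         ≤⟨ D-++ˡ-upper (φ x) (Φ w) ⟩
        length (φ x) + D (Φ w)                 ≤⟨ +-mono-≤ (φ-≤ x) (D-image-upper w) ⟩
        M + (D p + M * (D w + short w))        ≡⟨ +-assoc M (D p) _ ⟨
        M + D p + M * (D w + short w)          ≡⟨ cong (_+ M * (D w + short w)) (+-comm M (D p)) ⟩
        D p + M + M * (D w + short w)          ≡⟨ +-assoc (D p) M _ ⟩
        D p + (M + M * (D w + short w))        ≡⟨ cong (D p +_) (*-suc M _) ⟨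
        D p + M * suc (D w + short w)          ≤⟨ +-monoʳ-≤ (D p) (*-monoʳ-≤ M more) ⟩
        D p + M * (D (x ∷ w) + short (x ∷ w))  ∎
      shortNew : ∀ {v} → length v ≤ 2 → NewPrefix x w v → D (φ x ++ Φ w) ≤ D p + M * (D (x ∷ w) + short (x ∷ w))
      shortNew {v} v≤2 (_ , pre , new) = bad (begin
        suc (D w + short w)        ≡⟨ +-suc (D w) (short w) ⟨
        D w + suc (short w)        ≤⟨ +-mono-≤ (D-∷-lower x w)
          (occurring-mono-< (shortWords 2) (∈-shortWords v v≤2) (⊑-++ˡ [ x ] w) new ([] , pre)) ⟩
        D (x ∷ w) + short (x ∷ w)  ∎)
      step : D (φ x ++ Φ w) ≤ D p + M * (D (x ∷ w) + short (x ∷ w))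
      step with hasNew? x w
      ... | no ¬new = bad (begin
        suc (D w) + short w        ≡⟨ cong (_+ short w) (D-∷-old ¬new) ⟨
        D (x ∷ w) + short w        ≤⟨ +-monoʳ-≤ (D (x ∷ w)) short-≤ ⟩
        D (x ∷ w) + short (x ∷ w)  ∎)
      ... | yes ([] , new)    = shortNew z≤n new
      ... | yes (c ∷ [] , new) = shortNew (s≤s z≤n) new
      ... | yes (c ∷ d ∷ m , new@(pal , (r , pre) , _)) with ∷-injectiveˡ pre
      ... | refl with palindrome-core x (d ∷ m) (λ ()) pal
      ... | [] , e , _ = shortNew (≤-reflexive (cong (λ s → suc (length s)) e)) new
      ... | u@(_ ∷ _) , e , u-pal = begin
        D (φ x ++ Φ w)                         ≡⟨ D-∷-image u (λ ()) (subst (λ s → NewPrefix x w (x ∷ s)) e new) u-pal [] (φ x) refl ⟩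
        D (Φ w)                                ≤⟨ D-image-upper w ⟩
        D p + M * (D w + short w)              ≤⟨ +-monoʳ-≤ (D p) (*-monoʳ-≤ M (+-mono-≤ (D-∷-lower x w) short-≤)) ⟩
        D p + M * (D (x ∷ w) + short (x ∷ w))  ∎

    -- If `x` creates no palindrome, then by `new-preimage` prepending `ℓ x` creates none longer
    -- than `B`: it raises the defect or makes a short word appear for the first time. The rest of
    -- the block can lower neither term.
    D-image-lower : ∀ w → D w ≤ D (Φ w) + occurring (shortWords B) (Φ w)
    D-image-lower []      = z≤n
    D-image-lower (x ∷ w) with hasNew? x w
    ... | yes new = begin
      D (x ∷ w)                              ≡⟨ D-∷-new new ⟩
      D w                                    ≤⟨ D-image-lower w ⟩
      D (Φ w) + short (Φ w)                  ≤⟨ +-mono-≤ (D-++ˡ-lower (φ x) (Φ w)) (occurring-mono-≤ (shortWords B) (⊑-++ˡ (φ x) (Φ w))) ⟩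
      D (φ x ++ Φ w) + short (φ x ++ Φ w)    ≡⟨ cong (λ s → D s + short s) (Φ-∷ x w) ⟨
      D (Φ (x ∷ w)) + short (Φ (x ∷ w))      ∎
      where
      open ≤-Reasoning
      short : Word k → ℕ
      short = occurring (shortWords B)
    ... | no ¬new with φ-last x
    ... | f , e = begin
      D (x ∷ w)                              ≡⟨ D-∷-old ¬new ⟩
      suc (D w)                              ≤⟨ s≤s (D-image-lower w) ⟩
      suc (D (Φ w) + short (Φ w))            ≤⟨ step (hasNew? (ℓ x) (Φ w)) ⟩
      D (ℓ x ∷ Φ w) + short (ℓ x ∷ Φ w)      ≤⟨ +-mono-≤ (D-++ˡ-lower f _) (occurring-mono-≤ (shortWords B) (⊑-++ˡ f _)) ⟩
      D (f ++ ℓ x ∷ Φ w) + short (f ++ ℓ x ∷ Φ w) ≡⟨ cong (λ s → D s + short s) Φ≡ ⟨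
      D (Φ (x ∷ w)) + short (Φ (x ∷ w))      ∎
      where
      open ≤-Reasoning
      short : Word k → ℕ
      short = occurring (shortWords B)
      Φ≡ : Φ (x ∷ w) ≡ f ++ ℓ x ∷ Φ w
      Φ≡ = trans (Φ-∷ x w) (trans (cong (_++ Φ w) e) (++-assoc f [ ℓ x ] (Φ w)))
      step : Dec (HasNew (ℓ x) (Φ w)) → suc (D (Φ w) + short (Φ w)) ≤ D (ℓ x ∷ Φ w) + short (ℓ x ∷ Φ w)
      step (no ¬new′) = +-mono-≤ (≤-reflexive (sym (D-∷-old ¬new′)))
        (occurring-mono-≤ (shortWords B) (⊑-++ˡ [ ℓ x ] (Φ w)))
      step (yes (v , new@(_ , pre , ¬v⊑))) with length v ≤? B
      ... | yes v≤B = begin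
        suc (D (Φ w) + short (Φ w))         ≡⟨ +-suc (D (Φ w)) _ ⟨
        D (Φ w) + suc (short (Φ w))         ≤⟨ +-mono-≤ (D-∷-lower (ℓ x) (Φ w))
          (occurring-mono-< (shortWords B) (∈-shortWords v v≤B) (⊑-++ˡ [ ℓ x ] (Φ w)) ¬v⊑ ([] , pre)) ⟩
        D (ℓ x ∷ Φ w) + short (ℓ x ∷ Φ w)   ∎
      ... | no v≰B = contradiction (new-preimage longφ long new) ¬new
        where
        longφ : ∀ y → length (φ y ++ p) + 2 < length v
        longφ y = begin-strict
          length (φ y ++ p) + 2        ≡⟨ cong (_+ 2) (length-++ (φ y)) ⟩
          length (φ y) + length p + 2  ≤⟨ +-monoˡ-≤ 2 (+-monoˡ-≤ (length p) (φ-≤ y)) ⟩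
          B                            <⟨ ≰⇒> v≰B ⟩
          length v                     ∎
        long : length p + 1 < length v
        long = ≤-<-trans (+-mono-≤ (m≤n+m (length p) M) (s≤s z≤n)) (≰⇒> v≰B)

  length-φ* : ∀ w → length w ≤ length ((φ *) w)
  length-φ* []      = z≤n
  length-φ* (x ∷ w) = ≤-trans (+-mono-≤ (positive (φ-nonempty x)) (length-φ* w)) (≤-reflexive (sym (length-++ (φ x))))
    where
    positive : ∀ {u : Word k} → u ≢ [] → 1 ≤ length u
    positive {[]}    u≢[] = contradiction refl u≢[]
    positive {_ ∷ _} _    = s≤s z≤n

-- Passage to conjugate morphisms and infinite words

bounded : ∀ {k} (f : Fin k → ℕ) → ∃[ M ] ∀ x → f x ≤ M
bounded {zero}  f = 0 , λ ()
bounded {suc k} f with bounded (λ x → f (suc x))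
... | M , f≤M = f zero ⊔ M , λ where
  zero    → m≤m⊔n (f zero) M
  (suc x) → ≤-trans (f≤M x) (m≤n⊔m (f zero) M)

conjugate-* : ∀ {k} (σ φ : Morphism {k}) {p′ : Word k} → (∀ x → p′ ++ σ x ≡ φ x ++ p′) →
  ∀ w → p′ ++ (σ *) w ≡ (φ *) w ++ p′
conjugate-* σ φ {p′} conj []      = ++-identityʳ p′
conjugate-* σ φ {p′} conj (x ∷ w) = begin
  p′ ++ σ x ++ (σ *) w      ≡⟨ ++-assoc p′ (σ x) _ ⟨
  (p′ ++ σ x) ++ (σ *) w    ≡⟨ cong (_++ (σ *) w) (conj x) ⟩
  (φ x ++ p′) ++ (σ *) w    ≡⟨ ++-assoc (φ x) p′ _ ⟩
  φ x ++ p′ ++ (σ *) w      ≡⟨ cong (φ x ++_) (conjugate-* σ φ conj w) ⟩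
  φ x ++ (φ *) w ++ p′      ≡⟨ ++-assoc (φ x) _ p′ ⟨
  (φ x ++ (φ *) w) ++ p′    ∎
  where open ≡-Reasoning

segment-+ : ∀ {k} (t : InfWord k) i m n → segment t i (m + n) ≡ segment t i m ++ segment t (m + i) n
segment-+ t i zero    n = refl
segment-+ t i (suc m) n = cong (t i ∷_) (trans (segment-+ t (suc i) m n)
  (cong (λ j → segment t (suc i) m ++ segment t j n) (+-suc m i)))

length-segment : ∀ {k} (t : InfWord k) i n → length (segment t i n) ≡ n
length-segment t i zero    = refl
length-segment t i (suc n) = cong suc (length-segment t (suc i) n)

-- Reduces almost richness to prefixes: a segment is a suffix of a prefix, and extending to the left
-- never lowers the defect.
D-segment-prefix : ∀ {k} (t : InfWord k) i n → D (segment t i n) ≤ D (segment t 0 (i + n))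
D-segment-prefix t i n = ≤-trans (D-++ˡ-lower (segment t 0 i) _)
  (≤-reflexive (cong D (sym (trans (segment-+ t 0 i n) (cong (λ j → segment t 0 i ++ segment t j n) (+-identityʳ i))))))

D-prefix-mono : ∀ {k} (t : InfWord k) {m n} → m ≤ n → D (segment t 0 m) ≤ D (segment t 0 n)
D-prefix-mono t {m} {n} m≤n = ≤-trans (D-++ʳ-lower (segment t 0 m) (segment t (m + 0) (n ∸ m)))
  (≤-reflexive (cong D (trans (sym (segment-+ t 0 m (n ∸ m))) (cong (segment t 0) (m+[n∸m]≡n m≤n)))))

theorem6p24 : (k : ℕ) (σ : Morphism {k}) → IsSpecialP σ →
    (t s : InfWord k) → IsImage σ t s →
    AlmostRich s ⇔ AlmostRich t
theorem6p24 k σ (φ , p , p′ , p″ , p≡ , standard , special , conj) t s image = mk⇔ to from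
  where
  open SpecialStandard φ p standard special
  open ≤-Reasoning

  M : ℕ
  M = proj₁ (bounded (λ x → length (φ x)))

  open Bounds M (proj₂ (bounded (λ x → length (φ x))))

  -- Splitting `p` leaves `p′` right after the blocks; conjugation moves it to the front and turns
  -- `φ` into `σ`.
  Φ≡ : ∀ w → Φ w ≡ p′ ++ (σ *) w ++ p″
  Φ≡ w = trans (cong ((φ *) w ++_) p≡) (trans (sym (++-assoc ((φ *) w) p′ p″))
    (trans (cong (_++ p″) (sym (conjugate-* σ φ conj w))) (++-assoc p′ _ p″)))

  -- Conjugation preserves lengths and blocks are non-empty, so the image of a prefix of `t` covers
  -- a prefix of `s` of at least the same length.
  length-σ* : ∀ w → length w ≤ length ((σ *) w)
  length-σ* w = ≤-trans (length-φ* w) (≤-reflexive (+-cancelˡ-≡ (length p′) _ _ (sym (begin-equality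
    length p′ + length ((σ *) w)   ≡⟨ length-++ p′ ⟨
    length (p′ ++ (σ *) w)         ≡⟨ cong length (conjugate-* σ φ conj w) ⟩
    length ((φ *) w ++ p′)         ≡⟨ length-++ ((φ *) w) ⟩
    length ((φ *) w) + length p′   ≡⟨ +-comm _ (length p′) ⟩
    length p′ + length ((φ *) w)   ∎))))

  to : AlmostRich s → AlmostRich t
  -- Removing `p′` and `p″` costs at most their lengths; the last summand bounds the count of short
  -- words.
  to (K , s≤K) = length p′ + (length p″ + K) + length (shortWords {k} B) , λ i n →
    let w = segment t 0 (i + n) in begin
    D (segment t i n)                                  ≤⟨ D-segment-prefix t i n ⟩
    D w                                                ≤⟨ D-image-lower w ⟩
    D (Φ w) + occurring (shortWords B) (Φ w)           ≤⟨ +-monoʳ-≤ (D (Φ w)) (occurring-≤ (shortWords B) (Φ w)) ⟩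
    D (Φ w) + length (shortWords {k} B)                ≡⟨ cong (λ z → D z + length (shortWords {k} B)) (Φ≡ w) ⟩
    D (p′ ++ (σ *) w ++ p″) + length (shortWords {k} B) ≤⟨ +-monoˡ-≤ _ (D-++ˡ-upper p′ _) ⟩
    length p′ + D ((σ *) w ++ p″) + length (shortWords {k} B)
      ≤⟨ +-monoˡ-≤ _ (+-monoʳ-≤ (length p′) (D-++ʳ-upper ((σ *) w) p″)) ⟩
    length p′ + (length p″ + D ((σ *) w)) + length (shortWords {k} B)
      ≤⟨ +-monoˡ-≤ _ (+-monoʳ-≤ (length p′) (+-monoʳ-≤ (length p″)
           (≤-trans (≤-reflexive (cong D (image (i + n)))) (s≤K 0 (length ((σ *) w)))))) ⟩
    length p′ + (length p″ + K) + length (shortWords {k} B) ∎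

  from : AlmostRich t → AlmostRich s
  -- The bound of `D-image-upper` with both varying terms at their maxima.
  from (K , t≤K) = D p + M * (K + length (shortWords {k} 2)) , λ i n →
    let w = segment t 0 (i + n) in begin
    D (segment s i n)                                  ≤⟨ D-segment-prefix s i n ⟩
    D (segment s 0 (i + n))                            ≤⟨ D-prefix-mono s
      (≤-trans (≤-reflexive (sym (length-segment t 0 (i + n)))) (length-σ* w)) ⟩
    D (segment s 0 (length ((σ *) w)))                 ≡⟨ cong D (image (i + n)) ⟨
    D ((σ *) w)                                        ≤⟨ D-++ʳ-lower ((σ *) w) p″ ⟩
    D ((σ *) w ++ p″)                                  ≤⟨ D-++ˡ-lower p′ _ ⟩
    D (p′ ++ (σ *) w ++ p″)                            ≡⟨ cong D (Φ≡ w) ⟨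
    D (Φ w)                                            ≤⟨ D-image-upper w ⟩
    D p + M * (D w + occurring (shortWords 2) w)
      ≤⟨ +-monoʳ-≤ (D p) (*-monoʳ-≤ M (+-mono-≤ (t≤K 0 (i + n)) (occurring-≤ (shortWords 2) w))) ⟩
    D p + M * (K + length (shortWords {k} 2))          ∎
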